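{- Girard's call-by-value translation $(\cdot)^{*}$ is a simplification from outside of the outer full Girard translation $(\cdot)^{{\rm Gf}_o}$ (as translations from $\mathsf{IL}_{\rm b}$ to $\mathsf{ILL}$): for any formula $A$ of the language of $\mathsf{ILL}$, one obtains $A^{*}$ from $A^{{\rm Gf}_o}$ by systematically applying the following formula reductions, starting from the whole formula and inductively applying them to the subformulas: $$!(!A\otimes\,!B)\mapsto\,!A\otimes\,!B,\qquad !(!A\oplus\,!B)\mapsto\,!A\oplus\,!B,\qquad !\exists x\,!A\mapsto\exists x\,!A,\qquad !!!A\mapsto\,!!A.$$ Moreover, the reductions above are reversible in $\mathsf{ILL}$ (i.e. the two sides of each reduction are provably equivalent in $\mathsf{ILL}$).
   Context: Intuitionistic linear logic $\mathsf{ILL}$ (first order). Formulas are built from atomic formulas, including the constants $1,\top,0$, using $\otimes,\&,\oplus,\multimap$, $\forall x,\exists x$ and $!$. Sequents are $\Gamma\vdash A$ with $\Gamma$ a finite multiset of formulas and exactly one formula on the right. Axioms: $A\vdash A$; $\vdash 1$; $\Gamma\vdash\top$; $\Gamma,0\vdash C$. Rules (premises $\Rightarrow$ conclusion): (cut) $\Gamma\vdash A;\ \Delta,A\vdash C\Rightarrow\Gamma,\Delta\vdash C$; $\Gamma\vdash C\Rightarrow\Gamma,1\vdash C$; $\Gamma\vdash A;\ \Delta\vdash B\Rightarrow\Gamma,\Delta\vdash A\otimes B$; $\Gamma,A,B\vdash C\Rightarrow\Gamma,A\otimes B\vdash C$; $\Gamma,A\vdash B\Rightarrow\Gamma\vdash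 A\multimap B$; $\Gamma\vdash A;\ \Delta,B\vdash C\Rightarrow\Gamma,\Delta,A\multimap B\vdash C$; $\Gamma\vdash A;\ \Gamma\vdash B\Rightarrow\Gamma\vdash A\& B$; $\Gamma,A\vdash C\Rightarrow\Gamma,A\& B\vdash C$; $\Gamma,B\vdash C\Rightarrow\Gamma,A\& B\vdash C$; $\Gamma\vdash A\Rightarrow\Gamma\vdash A\oplus B$; $\Gamma\vdash B\Rightarrow\Gamma\vdash A\oplus B$; $\Gamma,A\vdash C;\ \Gamma,B\vdash C\Rightarrow\Gamma,A\oplus B\vdash C$; $\Gamma\vdash A\Rightarrow\Gamma\vdash\forall xA$; $\Gamma,A[t/x]\vdash C\Rightarrow\Gamma,\forall xA\vdash C$; $\Gamma\vdash A[t/x]\Rightarrow\Gamma\vdash\exists xA$; $\Gamma,A\vdash C\Rightarrow\Gamma,\exists xA\vdash C$ (usual eigenvariable conditions); $\Gamma,!A,!A\vdash C\Rightarrow\Gamma,!A\vdash C$; $\Gamma\vdash C\Rightarrow\Gamma,!A\vdash C$; $!\Gamma\vdash A\Rightarrow\,!\Gamma\vdash\,!A$; $\Gamma,A\vdash C\Rightarrow\Gamma,!A\vdash C$. $\mathsf{PRO}$ is the axiom schema $A\vdash\,!A$; $\mathsf{IL}_{\rm b}:=\mathsf{ILL}+\mathsf{PRO}$. Formulas $A,B$ are equivalent over $S$ if $S$ proves $(A\multimap B)\&(B\multimap A)$. Translations. Throughout $\square\in\{\otimes,\&,\oplus,\multimap\}$, $Q\in\{\forall x,\exists x,!\}$.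 Outer full Girard: $P^{{\rm Gf}_o}:=\,!P$ ($P$ atomic), $(A\,\square\,B)^{{\rm Gf}_o}:=\,!(A^{{\rm Gf}_o}\,\square\,B^{{\rm Gf}_o})$, $(QA)^{{\rm Gf}_o}:=\,!QA^{{\rm Gf}_o}$. Call-by-value: $P^*:=\,!P$ ($P$ atomic); $(A\otimes B)^*:=A^*\otimes B^*$; $(A\& B)^*:=\,!(A^*\& B^*)$; $(A\oplus B)^*:=A^*\oplus B^*$; $(A\multimap B)^*:=\,!(A^*\multimap B^*)$; $(\forall xA)^*:=\,!\forall xA^*$; $(\exists xA)^*:=\exists xA^*$; $(!A)^*:=\,!A^*$. General notions, for a formula construct $T$ (here $T(A)=\,!A$). A $T$-based outer-transform is $\mathcal T_\square(A,B)=T'(A\,\square\,B)$, resp. $\mathcal T_Q(A)=T'(QA)$, with $T'\in\{T,\mathrm{Id}\}$. A modular outer $T$-translation is one given by outer-transforms via $P^{\rm Tr}:=T(P)$ ($P$ atomic), $(A\,\square\,B)^{\rm Tr}:=\mathcal T^{\rm Tr}_\square(A^{\rm Tr},B^{\rm Tr})$, $(QA)^{\rm Tr}:=\mathcal T^{\rm Tr}_Q(A^{\rm Tr})$. A transform is simpler than another one for the same connective, quantifier or modality if the latter uses $T$ in all places where the former does, but not conversely. A translation is sound from $S_1$ to $S_2$ if for all $A$: $\vdash_{S_1}A$ implies $\vdash_{S_2}A^{\rm Tr}$, and $A$, $A^{\rm Tr}$ are equivalent over $S_1$. Two sound translations from $S_1$ to $S_2$ are equivalent if $A^{\rm Tr}$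 and $A^{{\rm Tr}'}$ are equivalent over $S_2$ for all $A$. For equivalent translations, ${\rm Tr}'$ is a simplification of ${\rm Tr}$ if each transform of ${\rm Tr}'$ is identical to or simpler than the corresponding one of ${\rm Tr}$, and simpler in at least one case. For two equivalent modular outer $T$-translations, ${\rm Tr}'$ is a simplification from outside of ${\rm Tr}$ if it is a simplification of ${\rm Tr}$ and $A^{{\rm Tr}'}$ is obtained from $A^{\rm Tr}$ by applying the reductions $\mathcal T^{\rm Tr}_\square(T(A),T(B))\mapsto\mathcal T^{{\rm Tr}'}_\square(T(A),T(B))$ and $\mathcal T^{\rm Tr}_Q(T(A))\mapsto\mathcal T^{{\rm Tr}'}_Q(T(A))$ recursively, starting from the whole formula and working towards the atomic formulas (at each stage the reduction matching the current formula, if there is one, is applied to it, and one then continues with the parts $T(A)$, $T(B)$ that are the translations of the immediate subformulas). -}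

module Defs where

open import Data.Empty using (⊥)
open import Data.List using (List; []; _∷_; [_]; _++_; map)
open import Data.List.Relation.Binary.Permutation.Propositional using (_↭_)
open import Data.Nat using (ℕ; zero; suc)
open import Data.Product using (_×_; ∃-syntax)
open import Data.Sum using (_⊎_)
open import Data.Vec using (Vec; []; _∷_)
open import Function using (_∘_)
open import Relation.Binary.PropositionalEquality using (_≡_; refl)
open import Relation.Nullary using (¬_)

-- Symbols are indexed by their arity.
record Signature : Set₁ where
  field
    Function  : ℕ → Set
    Predicate : ℕ → Set

module LinearLogic (𝓢 : Signature) where

  open Signature 𝓢

  ----------------------------------------------------------------------
  -- Syntax

  -- Variables are de Bruijn indices ranging over all of ℕ, so that every
  -- sequent has an unlimited supply of free variables (as with named
  -- variables, the domain is never empty, even without closed terms).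
  data Term : Set where
    var : ℕ → Term
    fun : ∀ {n} → Function n → Vec Term n → Term

  data Atom : Set where
    pred     : ∀ {n} → Predicate n → Vec Term n → Atom
    one      : Atom
    top      : Atom
    zeroAtom : Atom

  data Connective : Set where
    tensor with′ plus lolli : Connective

  data Modifier : Set where
    forall′ exists bang : Modifier

  -- `mod forall′ A` and `mod exists A` bind index 0 of A;
  -- `mod bang A` binds nothing.
  data Formula : Set where
    atom : Atom → Formula
    bin  : Connective → Formula → Formula → Formula
    mod  : Modifier → Formula → Formula

  pattern 𝟏 = atom one
  pattern ⊤′ = atom top
  pattern 𝟎 = atom zeroAtom

  infixr 8 _⊗_ _&_ _⊕_
  infixr 7 _⊸_
  infixr 9 !_ ∀′_ ∃′_

  pattern _⊗_ A B = bin tensor A B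
  pattern _&_ A B = bin with′ A B
  pattern _⊕_ A B = bin plus A B
  pattern _⊸_ A B = bin lolli A B
  pattern ∀′_ A = mod forall′ A
  pattern ∃′_ A = mod exists A
  pattern !_ A = mod bang A

  ----------------------------------------------------------------------
  -- Substitution

  Substitution : Set
  Substitution = ℕ → Term

  mutual
    substTerm : Substitution → Term → Term
    substTerm σ (var i)    = σ i
    substTerm σ (fun f ts) = fun f (substTerms σ ts)

    substTerms : ∀ {n} → Substitution → Vec Term n → Vec Term n
    substTerms σ []       = []
    substTerms σ (t ∷ ts) = substTerm σ t ∷ substTerms σ ts

  lift : Substitution → Substitution
  lift σ zero    = var zero
  lift σ (suc i) = substTerm (var ∘ suc) (σ i)

  substAtom : Substitution → Atom → Atom
  substAtom σ (pred p ts) = pred p (substTerms σ ts)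
  substAtom σ one         = one
  substAtom σ top         = top
  substAtom σ zeroAtom    = zeroAtom

  subst : Substitution → Formula → Formula
  subst σ (atom P)    = atom (substAtom σ P)
  subst σ (bin c A B) = bin c (subst σ A) (subst σ B)
  subst σ (∀′ A)      = ∀′ subst (lift σ) A
  subst σ (∃′ A)      = ∃′ subst (lift σ) A
  subst σ (! A)       = ! subst σ A

  shift : Formula → Formula
  shift = subst (var ∘ suc)

  single : Term → Substitution
  single t zero    = t
  single t (suc i) = var i

  infix 10 _[_/0]

  _[_/0] : Formula → Term → Formula
  A [ t /0] = subst (single t) A

  ----------------------------------------------------------------------
  -- Sequent calculus

  Context : Set
  Context = List Formula

  System : Set₁
  System = Context → Formula → Set

  -- Intuitionistic linear logic with additional axioms Ax.  Contexts are
  -- multisets: lists up to permutation, by rule `exchange`.  In ∀R and ∃L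
  -- the shift makes index 0 fresh for the side formulas, which is the
  -- eigenvariable condition.
  module Calculus (Ax : System) where

    infix 4 _⊢_

    data _⊢_ : Context → Formula → Set where
      axiom    : ∀ {Γ A} → Ax Γ A → Γ ⊢ A
      exchange : ∀ {Γ Δ A} → Γ ↭ Δ → Γ ⊢ A → Δ ⊢ A

      identity : ∀ {A} → [ A ] ⊢ A
      cut      : ∀ {Γ Δ A C} → Γ ⊢ A → A ∷ Δ ⊢ C → Γ ++ Δ ⊢ C

      𝟏R : [] ⊢ 𝟏
      𝟏L : ∀ {Γ C} → Γ ⊢ C → 𝟏 ∷ Γ ⊢ C
      ⊤R : ∀ {Γ} → Γ ⊢ ⊤′
      𝟎L : ∀ {Γ C} → 𝟎 ∷ Γ ⊢ C

      ⊗R : ∀ {Γ Δ A B} → Γ ⊢ A → Δ ⊢ B → Γ ++ Δ ⊢ A ⊗ B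
      ⊗L : ∀ {Γ A B C} → A ∷ B ∷ Γ ⊢ C → A ⊗ B ∷ Γ ⊢ C
      ⊸R : ∀ {Γ A B} → A ∷ Γ ⊢ B → Γ ⊢ A ⊸ B
      ⊸L : ∀ {Γ Δ A B C} → Γ ⊢ A → B ∷ Δ ⊢ C → A ⊸ B ∷ Γ ++ Δ ⊢ C

      &R  : ∀ {Γ A B} → Γ ⊢ A → Γ ⊢ B → Γ ⊢ A & B
      &L₁ : ∀ {Γ A B C} → A ∷ Γ ⊢ C → A & B ∷ Γ ⊢ C
      &L₂ : ∀ {Γ A B C} → B ∷ Γ ⊢ C → A & B ∷ Γ ⊢ C
      ⊕R₁ : ∀ {Γ A B} → Γ ⊢ A → Γ ⊢ A ⊕ B
      ⊕R₂ : ∀ {Γ A B} → Γ ⊢ B → Γ ⊢ A ⊕ B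
      ⊕L  : ∀ {Γ A B C} → A ∷ Γ ⊢ C → B ∷ Γ ⊢ C → A ⊕ B ∷ Γ ⊢ C

      ∀R : ∀ {Γ A} → map shift Γ ⊢ A → Γ ⊢ ∀′ A
      ∀L : ∀ {Γ A C} t → A [ t /0] ∷ Γ ⊢ C → ∀′ A ∷ Γ ⊢ C
      ∃R : ∀ {Γ A} t → Γ ⊢ A [ t /0] → Γ ⊢ ∃′ A
      ∃L : ∀ {Γ A C} → A ∷ map shift Γ ⊢ shift C → ∃′ A ∷ Γ ⊢ C

      contraction : ∀ {Γ A C} → ! A ∷ ! A ∷ Γ ⊢ C → ! A ∷ Γ ⊢ C
      weakening   : ∀ {Γ A C} → Γ ⊢ C → ! A ∷ Γ ⊢ C
      promotion   : ∀ {Γ A} → map !_ Γ ⊢ A → map !_ Γ ⊢ ! A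
      dereliction : ∀ {Γ A C} → A ∷ Γ ⊢ C → ! A ∷ Γ ⊢ C

  data PRO : System where
    pro : ∀ {A} → PRO [ A ] (! A)

  ILL : System
  ILL = Calculus._⊢_ (λ _ _ → ⊥)

  ILb : System
  ILb = Calculus._⊢_ PRO

  Equivalent : System → Formula → Formula → Set
  Equivalent S A B = S [] ((A ⊸ B) & (B ⊸ A))

  ----------------------------------------------------------------------
  -- Translations

  Translation : Set
  Translation = Formula → Formula

  Sound : System → System → Translation → Set
  Sound S₁ S₂ tr =
    (∀ A → S₁ [] A → S₂ [] (tr A)) × (∀ A → Equivalent S₁ A (tr A))

  EquivalentTranslations : System → System → Translation → Translation → Set
  EquivalentTranslations S₁ S₂ tr tr′ =
    Sound S₁ S₂ tr × Sound S₁ S₂ tr′ × (∀ A → Equivalent S₂ (tr A) (tr′ A))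

  -- The choice T′ ∈ {T , Id} of an outer-transform.
  data Choice : Set where
    useT useId : Choice

  -- The only place where an outer-transform may use T is the outermost one.
  Simpler : Choice → Choice → Set
  Simpler k′ k = (k′ ≡ useT → k ≡ useT) × ¬ (k ≡ useT → k′ ≡ useT)

  IdenticalOrSimpler : Choice → Choice → Set
  IdenticalOrSimpler k′ k = k′ ≡ k ⊎ Simpler k′ k

  module Outer (T : Formula → Formula) where

    apply : Choice → Formula → Formula
    apply useT  A = T A
    apply useId A = A

    record ModularOuterTranslation : Set where
      field
        binChoice : Connective → Choice
        modChoice : Modifier → Choice

      binTransform : Connective → Formula → Formula → Formula
      binTransform c A B = apply (binChoice c) (bin c A B)

      modTransform : Modifier → Formula → Formula
      modTransform q A = apply (modChoice q) (mod q A)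

      field
        tr      : Translation
        tr-atom : ∀ P → tr (atom P) ≡ T (atom P)
        tr-bin  : ∀ c A B → tr (bin c A B) ≡ binTransform c (tr A) (tr B)
        tr-mod  : ∀ q A → tr (mod q A) ≡ modTransform q (tr A)

    open ModularOuterTranslation

    record IsSimplification (S₁ S₂ : System)
                            (Tr′ Tr : ModularOuterTranslation) : Set where
      field
        equivalent  : EquivalentTranslations S₁ S₂ (tr Tr′) (tr Tr)
        bin-simpler : ∀ c → IdenticalOrSimpler (binChoice Tr′ c) (binChoice Tr c)
        mod-simpler : ∀ q → IdenticalOrSimpler (modChoice Tr′ q) (modChoice Tr q)
        one-simpler : (∃[ c ] Simpler (binChoice Tr′ c) (binChoice Tr c))
                    ⊎ (∃[ q ] Simpler (modChoice Tr′ q) (modChoice Tr q))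

    data TransformReduction (Tr Tr′ : ModularOuterTranslation) :
                            Formula → Formula → Set where
      bin : ∀ c A B → TransformReduction Tr Tr′
              (binTransform Tr c (T A) (T B)) (binTransform Tr′ c (T A) (T B))
      mod : ∀ q A → TransformReduction Tr Tr′
              (modTransform Tr q (T A)) (modTransform Tr′ q (T A))

    -- The matching reduction is applied if there is one.
    Stage : (Formula → Formula → Set) → Formula → Formula → Set
    Stage _↦_ A B = A ↦ B ⊎ ((∀ C → ¬ (A ↦ C)) × A ≡ B)

    -- `FromOutside _↦_ Tr′ A B`: B results from A by applying the reductions
    -- _↦_ from the whole formula inwards.  The transforms of Tr′ serve to
    -- locate, in the outcome of each stage, the parts T A and T B on which
    -- one continues.
    data FromOutside (_↦_ : Formula → Formula → Set)
                     (Tr′ : ModularOuterTranslation) :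
                     Formula → Formula → Set where
      atom : ∀ P →
        (∀ C → ¬ (T (atom P) ↦ C)) →
        FromOutside _↦_ Tr′ (T (atom P)) (T (atom P))
      bin : ∀ c {X A B A′ B′} →
        Stage _↦_ X (binTransform Tr′ c (T A) (T B)) →
        FromOutside _↦_ Tr′ (T A) A′ →
        FromOutside _↦_ Tr′ (T B) B′ →
        FromOutside _↦_ Tr′ X (binTransform Tr′ c A′ B′)
      mod : ∀ q {X A A′} →
        Stage _↦_ X (modTransform Tr′ q (T A)) →
        FromOutside _↦_ Tr′ (T A) A′ →
        FromOutside _↦_ Tr′ X (modTransform Tr′ q A′)

    record IsSimplificationFromOutside (S₁ S₂ : System)
                                       (Tr′ Tr : ModularOuterTranslation) : Set where
      field
        isSimplification : IsSimplification S₁ S₂ Tr′ Tr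
        fromOutside      : ∀ A →
          FromOutside (TransformReduction Tr Tr′) Tr′ (tr Tr A) (tr Tr′ A)

  open Outer !_ public

  ----------------------------------------------------------------------
  -- The outer full Girard and the call-by-value translations

  infix 10 _ᴳᶠ _*

  _ᴳᶠ : Translation
  (atom P)    ᴳᶠ = ! atom P
  (bin c A B) ᴳᶠ = ! bin c (A ᴳᶠ) (B ᴳᶠ)
  (mod q A)   ᴳᶠ = ! mod q (A ᴳᶠ)

  _* : Translation
  (atom P) * = ! atom P
  (A ⊗ B)  * = A * ⊗ B *
  (A & B)  * = ! (A * & B *)
  (A ⊕ B)  * = A * ⊕ B *
  (A ⊸ B)  * = ! (A * ⊸ B *)
  (∀′ A)   * = ! ∀′ (A *)
  (∃′ A)   * = ∃′ (A *)
  (! A)    * = ! (A *)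

  outerFullGirard : ModularOuterTranslation
  outerFullGirard = record
    { binChoice = λ _ → useT
    ; modChoice = λ _ → useT
    ; tr        = _ᴳᶠ
    ; tr-atom   = λ _ → refl
    ; tr-bin    = λ _ _ _ → refl
    ; tr-mod    = λ _ _ → refl
    }

  callByValue : ModularOuterTranslation
  callByValue = record
    { binChoice = λ { tensor → useId ; with′ → useT ; plus → useId ; lolli → useT }
    ; modChoice = λ { forall′ → useT ; exists → useId ; bang → useId }
    ; tr        = _*
    ; tr-atom   = λ _ → refl
    ; tr-bin    = λ { tensor _ _ → refl ; with′ _ _ → refl
                    ; plus   _ _ → refl ; lolli _ _ → refl }
    ; tr-mod    = λ { forall′ _ → refl ; exists _ → refl ; bang _ → refl }
    }

  infix 4 _↦_

  data _↦_ : Formula → Formula → Set where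
    ⊗↦ : ∀ A B → ! (! A ⊗ ! B) ↦ ! A ⊗ ! B
    ⊕↦ : ∀ A B → ! (! A ⊕ ! B) ↦ ! A ⊕ ! B
    ∃↦ : ∀ A → ! ∃′ ! A ↦ ∃′ ! A
    !↦ : ∀ A → ! ! ! A ↦ ! ! A

{-# OPTIONS --safe #-}
-- Call a formula A stable if A ⊢ !A.  Banged formulas are stable, and ⊗, ⊕ and
-- ∃ preserve stability; this makes the four reductions reversible in ILL, and
-- every A * stable.  Contexts of stable formulas admit promotion, which
-- validates, under _*, both PRO and the right rules of the connectives that _*
-- bangs.  Stability of A * also identifies A ᴳᶠ with A * over ILL, so that the
-- soundness of _ᴳᶠ follows from that of _*.
module Submission where

open import Defs
open import Data.Empty using (⊥)
open import Data.List using ([]; _∷_; [_]; _++_; map)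
open import Data.List.Properties using (++-identityʳ; map-++; map-∘; map-cong)
open import Data.List.Relation.Binary.Permutation.Propositional as Permutation using (↭-sym)
open import Data.List.Relation.Binary.Permutation.Propositional.Properties using (map⁺; shift)
open import Data.List.Relation.Unary.All using (All; []; _∷_; universal)
import Data.List.Relation.Unary.All.Properties as All
open import Data.Nat using (zero; suc)
open import Data.Product using (_×_; _,_; proj₁; swap)
open import Data.Sum using (inj₁; inj₂)
open import Data.Vec using (Vec; []; _∷_)
open import Function using (_∘_; case_of_)
open import Relation.Binary.PropositionalEquality
  using (_≡_; refl; sym; trans; cong; cong₂) renaming (subst to transport)
open import Relation.Nullary using (¬_)

module _ (𝓢 : Signature) where

  open LinearLogic 𝓢 renaming (shift to shiftFormula)

  -- Cancellation of substitutions

  mutual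
    substTerm-∘ : ∀ τ σ t → substTerm τ (substTerm σ t) ≡ substTerm (substTerm τ ∘ σ) t
    substTerm-∘ τ σ (var i)    = refl
    substTerm-∘ τ σ (fun f ts) = cong (fun f) (substTerms-∘ τ σ ts)

    substTerms-∘ : ∀ {n} τ σ (ts : Vec Term n) →
      substTerms τ (substTerms σ ts) ≡ substTerms (substTerm τ ∘ σ) ts
    substTerms-∘ τ σ []       = refl
    substTerms-∘ τ σ (t ∷ ts) = cong₂ _∷_ (substTerm-∘ τ σ t) (substTerms-∘ τ σ ts)

  -- Stated pointwise on variables, so that it passes under binders without function extensionality.
  -- For formulas only composites equal to the identity are needed.
  LeftInverse : Substitution → Substitution → Set
  LeftInverse τ σ = ∀ i → substTerm τ (σ i) ≡ var i

  lift-leftInverse : ∀ {τ σ} → LeftInverse τ σ → LeftInverse (lift τ) (lift σ)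
  lift-leftInverse inv zero = refl
  lift-leftInverse {τ} {σ} inv (suc i) =
    -- `substTerm (lift τ) ∘ (var ∘ suc)` and `substTerm (var ∘ suc) ∘ τ` are the same function by
    -- definition, so `lift τ` after a shift becomes a shift after `τ`.
    trans (substTerm-∘ (lift τ) (var ∘ suc) (σ i))
      (trans (sym (substTerm-∘ (var ∘ suc) τ (σ i)))
        (cong (substTerm (var ∘ suc)) (inv i)))

  mutual
    substTerm-leftInverse : ∀ {τ σ} → LeftInverse τ σ → ∀ t →
      substTerm τ (substTerm σ t) ≡ t
    substTerm-leftInverse inv (var i)    = inv i
    substTerm-leftInverse inv (fun f ts) = cong (fun f) (substTerms-leftInverse inv ts)

    substTerms-leftInverse : ∀ {n τ σ} → LeftInverse τ σ → ∀ (ts : Vec Term n) →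
      substTerms τ (substTerms σ ts) ≡ ts
    substTerms-leftInverse inv []       = refl
    substTerms-leftInverse inv (t ∷ ts) =
      cong₂ _∷_ (substTerm-leftInverse inv t) (substTerms-leftInverse inv ts)

  substAtom-leftInverse : ∀ {τ σ} → LeftInverse τ σ → ∀ P →
    substAtom τ (substAtom σ P) ≡ P
  substAtom-leftInverse inv (pred p ts) = cong (pred p) (substTerms-leftInverse inv ts)
  substAtom-leftInverse inv one         = refl
  substAtom-leftInverse inv top         = refl
  substAtom-leftInverse inv zeroAtom    = refl

  subst-leftInverse : ∀ {τ σ} → LeftInverse τ σ → ∀ A → subst τ (subst σ A) ≡ A
  subst-leftInverse inv (atom P)    = cong atom (substAtom-leftInverse inv P)
  subst-leftInverse inv (bin c A B) =
    cong₂ (bin c) (subst-leftInverse inv A) (subst-leftInverse inv B)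
  subst-leftInverse inv (∀′ A) = cong ∀′_ (subst-leftInverse (lift-leftInverse inv) A)
  subst-leftInverse inv (∃′ A) = cong ∃′_ (subst-leftInverse (lift-leftInverse inv) A)
  subst-leftInverse inv (! A)  = cong !_ (subst-leftInverse inv A)

  -- Shifting under a binder fixes index 0 and raises the others; instantiating at `var zero` fixes
  -- index 0 and lowers them again. This lets the eigenvariable serve as a witness in the next two
  -- quantifier rules.
  rename-instance : ∀ A → subst (lift (var ∘ suc)) A [ var zero /0] ≡ A
  rename-instance = subst-leftInverse λ { zero → refl ; (suc i) → refl }

  -- Derived rules over arbitrary axioms

  module Derived (Ax : System) where

    open Calculus Ax public

    infix 4 _⊣⊢_

    _⊣⊢_ : Formula → Formula → Set
    A ⊣⊢ B = ([ A ] ⊢ B) × ([ B ] ⊢ A)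

    ⊣⊢-refl : ∀ {A} → A ⊣⊢ A
    ⊣⊢-refl = identity , identity

    ⊣⊢-trans : ∀ {A B C} → A ⊣⊢ B → B ⊣⊢ C → A ⊣⊢ C
    ⊣⊢-trans (f , f′) (g , g′) = cut f g , cut g′ f′

    ⊣⊢⇒Equivalent : ∀ {A B} → A ⊣⊢ B → Equivalent _⊢_ A B
    ⊣⊢⇒Equivalent (f , g) = &R (⊸R f) (⊸R g)

    ∀L-eigen : ∀ {A C} → [ A ] ⊢ C → [ shiftFormula (∀′ A) ] ⊢ C
    ∀L-eigen {A} {C} f =
      ∀L (var zero) (transport (λ F → [ F ] ⊢ C) (sym (rename-instance A)) f)

    ∃R-eigen : ∀ {Γ A} → Γ ⊢ A → Γ ⊢ shiftFormula (∃′ A)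
    ∃R-eigen {Γ} {A} f = ∃R (var zero) (transport (Γ ⊢_) (sym (rename-instance A)) f)

    -- Both directions are assumed because `⊸` is contravariant on the left.
    bin-mono : ∀ c {A A′ B B′} → A ⊣⊢ A′ → B ⊣⊢ B′ → [ bin c A B ] ⊢ bin c A′ B′
    bin-mono tensor (f , _) (g , _) = ⊗L (⊗R f g)
    bin-mono with′  (f , _) (g , _) = &R (&L₁ f) (&L₂ g)
    bin-mono plus   (f , _) (g , _) = ⊕L (⊕R₁ f) (⊕R₂ g)
    bin-mono lolli  (_ , f) (g , _) =
      ⊸R (exchange (Permutation.swap _ _ Permutation.refl) (⊸L f g))

    mod-mono : ∀ q {A A′} → [ A ] ⊢ A′ → [ mod q A ] ⊢ mod q A′
    mod-mono forall′ f = ∀R (∀L-eigen f)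
    mod-mono exists  f = ∃L (∃R-eigen f)
    mod-mono bang {A} f = promotion {Γ = [ A ]} (dereliction f)

    bin-cong : ∀ c {A A′ B B′} → A ⊣⊢ A′ → B ⊣⊢ B′ → bin c A B ⊣⊢ bin c A′ B′
    bin-cong c p q = bin-mono c p q , bin-mono c (swap p) (swap q)

    mod-cong : ∀ q {A A′} → A ⊣⊢ A′ → mod q A ⊣⊢ mod q A′
    mod-cong q (f , g) = mod-mono q f , mod-mono q g

    -- Stable formulas and promotion

    Stable : Formula → Set
    Stable A = [ A ] ⊢ ! A

    stable⇒⊣⊢ : ∀ {A} → Stable A → A ⊣⊢ ! A
    stable⇒⊣⊢ s = s , dereliction identity

    -- Induction on `Γ`: dereliction replaces `B` by `! B` in the premise, and a cut against
    -- `B ⊢ ! B` restores `B` in the conclusion. `Δ` accumulates the banged formulas until the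
    -- promotion rule applies.
    promote-mixed : ∀ Γ Δ {A} → All Stable Γ →
      map !_ Δ ++ Γ ⊢ A → map !_ Δ ++ Γ ⊢ ! A
    promote-mixed [] Δ [] d rewrite ++-identityʳ (map !_ Δ) = promotion d
    promote-mixed (B ∷ Γ) Δ (s ∷ ss) d =
      exchange (↭-sym moved)
        (cut s (promote-mixed Γ (B ∷ Δ) ss (dereliction (exchange moved d))))
      where moved = shift B (map !_ Δ) Γ

    promote : ∀ {Γ A} → All Stable Γ → Γ ⊢ A → Γ ⊢ ! A
    promote {Γ} = promote-mixed Γ []

    stable-! : ∀ {A} → Stable (! A)
    stable-! {A} = promotion {Γ = [ A ]} identity

    -- Once the left rule has decomposed the formula, the context is stable and `promote` applies.
    -- The same holds for `⊕` and `∃′`.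
    stable-⊗ : ∀ {A B} → Stable A → Stable B → Stable (A ⊗ B)
    stable-⊗ s t = ⊗L (promote (s ∷ t ∷ []) (⊗R identity identity))

    stable-⊕ : ∀ {A B} → Stable A → Stable B → Stable (A ⊕ B)
    stable-⊕ s t =
      ⊕L (promote (s ∷ []) (⊕R₁ identity)) (promote (t ∷ []) (⊕R₂ identity))

    stable-∃ : ∀ {A} → Stable A → Stable (∃′ A)
    stable-∃ s = ∃L (promote (s ∷ []) (∃R-eigen identity))

  -- The two systems

  module LL = Derived (λ _ _ → ⊥)
  module LLb = Derived PRO

  -- Over IL_b every formula is stable, so it is immaterial where ! is inserted.
  module _ where
    open LLb
    open ModularOuterTranslation

    apply-⊣⊢ : ∀ k {A} → A ⊣⊢ apply k A
    apply-⊣⊢ useT  = stable⇒⊣⊢ (axiom pro)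
    apply-⊣⊢ useId = ⊣⊢-refl

    modular-⊣⊢ : ∀ Tr A → A ⊣⊢ tr Tr A
    modular-⊣⊢ Tr (atom P) =
      transport (atom P ⊣⊢_) (sym (tr-atom Tr P)) (apply-⊣⊢ useT)
    modular-⊣⊢ Tr (bin c A B) =
      transport (bin c A B ⊣⊢_) (sym (tr-bin Tr c A B))
        (⊣⊢-trans (bin-cong c (modular-⊣⊢ Tr A) (modular-⊣⊢ Tr B))
                  (apply-⊣⊢ (binChoice Tr c)))
    modular-⊣⊢ Tr (mod q A) =
      transport (mod q A ⊣⊢_) (sym (tr-mod Tr q A))
        (⊣⊢-trans (mod-cong q (modular-⊣⊢ Tr A)) (apply-⊣⊢ (modChoice Tr q)))

  -- Equivalence of the two translations over ILL

  *-stable : ∀ A → LL.Stable (A *)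
  *-stable (atom P) = LL.stable-!
  *-stable (A ⊗ B)  = LL.stable-⊗ (*-stable A) (*-stable B)
  *-stable (A & B)  = LL.stable-!
  *-stable (A ⊕ B)  = LL.stable-⊕ (*-stable A) (*-stable B)
  *-stable (A ⊸ B)  = LL.stable-!
  *-stable (∀′ A)   = LL.stable-!
  *-stable (∃′ A)   = LL.stable-∃ (*-stable A)
  *-stable (! A)    = LL.stable-!

  -- Where `_*` omits the outer bang, `outer` restores it by stability; the rest is congruence.
  *⊣⊢ᴳᶠ : ∀ A → A * LL.⊣⊢ A ᴳᶠ
  *⊣⊢ᴳᶠ (atom P) = LL.⊣⊢-refl
  *⊣⊢ᴳᶠ (bin c A B) =
    LL.⊣⊢-trans (outer c) (LL.mod-cong bang (LL.bin-cong c (*⊣⊢ᴳᶠ A) (*⊣⊢ᴳᶠ B)))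
    where
    outer : ∀ c → bin c A B * LL.⊣⊢ ! bin c (A *) (B *)
    outer tensor = LL.stable⇒⊣⊢ (*-stable (A ⊗ B))
    outer with′  = LL.⊣⊢-refl
    outer plus   = LL.stable⇒⊣⊢ (*-stable (A ⊕ B))
    outer lolli  = LL.⊣⊢-refl
  *⊣⊢ᴳᶠ (mod q A) = LL.⊣⊢-trans (outer q) (LL.mod-cong bang (LL.mod-cong q (*⊣⊢ᴳᶠ A)))
    where
    outer : ∀ q → mod q A * LL.⊣⊢ ! mod q (A *)
    outer forall′ = LL.⊣⊢-refl
    outer exists  = LL.stable⇒⊣⊢ (*-stable (∃′ A))
    outer bang    = LL.stable⇒⊣⊢ (*-stable (! A))

  -- Soundness of the translations

  *-subst : ∀ σ A → subst σ A * ≡ subst σ (A *)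
  *-subst σ (atom P) = refl
  *-subst σ (A ⊗ B)  = cong₂ _⊗_ (*-subst σ A) (*-subst σ B)
  *-subst σ (A & B)  = cong !_ (cong₂ _&_ (*-subst σ A) (*-subst σ B))
  *-subst σ (A ⊕ B)  = cong₂ _⊕_ (*-subst σ A) (*-subst σ B)
  *-subst σ (A ⊸ B)  = cong !_ (cong₂ _⊸_ (*-subst σ A) (*-subst σ B))
  *-subst σ (∀′ A)   = cong (λ F → ! ∀′ F) (*-subst (lift σ) A)
  *-subst σ (∃′ A)   = cong ∃′_ (*-subst (lift σ) A)
  *-subst σ (! A)    = cong !_ (*-subst σ A)

  map-*-commute : ∀ {f g : Formula → Formula} → (∀ A → f A * ≡ g (A *)) →
    ∀ Γ → map _* (map f Γ) ≡ map g (map _* Γ)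
  map-*-commute f*≡g Γ = trans (sym (map-∘ Γ)) (trans (map-cong f*≡g Γ) (map-∘ Γ))

  module _ where
    open LL

    promote-* : ∀ Γ {A} → map _* Γ ⊢ A → map _* Γ ⊢ ! A
    promote-* Γ = promote (All.map⁺ (universal *-stable Γ))

    -- Stated for sequents so that induction on derivations goes through. An outer bang inserted by
    -- `_*` is removed by `dereliction` on the left and supplied by `promote-*` on the right.
    *-preserves-⊢ : ∀ {Γ A} → Γ LLb.⊢ A → map _* Γ ⊢ A *
    *-preserves-⊢ (LLb.axiom (pro {A})) = *-stable A
    *-preserves-⊢ (LLb.exchange p d) = exchange (map⁺ _* p) (*-preserves-⊢ d)
    *-preserves-⊢ LLb.identity = identity
    *-preserves-⊢ (LLb.cut {Γ} {Δ} d e) rewrite map-++ _* Γ Δ =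
      cut (*-preserves-⊢ d) (*-preserves-⊢ e)
    *-preserves-⊢ LLb.𝟏R = promote-* [] 𝟏R
    -- The constant `𝟏` is atomic, so it translates to `! 𝟏`, which can be weakened in.
    *-preserves-⊢ (LLb.𝟏L d) = weakening (*-preserves-⊢ d)
    *-preserves-⊢ (LLb.⊤R {Γ}) = promote-* Γ ⊤R
    *-preserves-⊢ LLb.𝟎L = dereliction 𝟎L
    *-preserves-⊢ (LLb.⊗R {Γ} {Δ} d e) rewrite map-++ _* Γ Δ =
      ⊗R (*-preserves-⊢ d) (*-preserves-⊢ e)
    *-preserves-⊢ (LLb.⊗L d) = ⊗L (*-preserves-⊢ d)
    *-preserves-⊢ (LLb.⊸R {Γ} d) = promote-* Γ (⊸R (*-preserves-⊢ d))
    *-preserves-⊢ (LLb.⊸L {Γ} {Δ} d e) rewrite map-++ _* Γ Δ =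
      dereliction (⊸L (*-preserves-⊢ d) (*-preserves-⊢ e))
    *-preserves-⊢ (LLb.&R {Γ} d e) =
      promote-* Γ (&R (*-preserves-⊢ d) (*-preserves-⊢ e))
    *-preserves-⊢ (LLb.&L₁ d) = dereliction (&L₁ (*-preserves-⊢ d))
    *-preserves-⊢ (LLb.&L₂ d) = dereliction (&L₂ (*-preserves-⊢ d))
    *-preserves-⊢ (LLb.⊕R₁ d) = ⊕R₁ (*-preserves-⊢ d)
    *-preserves-⊢ (LLb.⊕R₂ d) = ⊕R₂ (*-preserves-⊢ d)
    *-preserves-⊢ (LLb.⊕L d e) = ⊕L (*-preserves-⊢ d) (*-preserves-⊢ e)
    *-preserves-⊢ (LLb.∀R {Γ} {A} d) = promote-* Γ (∀R
      (transport (_⊢ A *) (map-*-commute (*-subst (var ∘ suc)) Γ) (*-preserves-⊢ d)))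
    *-preserves-⊢ (LLb.∀L {Γ} {A} {C} t d) = dereliction (∀L t
      (transport (λ F → F ∷ map _* Γ ⊢ C *) (*-subst (single t) A) (*-preserves-⊢ d)))
    *-preserves-⊢ (LLb.∃R {Γ} {A} t d) =
      ∃R t (transport (map _* Γ ⊢_) (*-subst (single t) A) (*-preserves-⊢ d))
    *-preserves-⊢ (LLb.∃L {Γ} {A} {C} d) =
      ∃L (transport (A * ∷ map shiftFormula (map _* Γ) ⊢_) (*-subst (var ∘ suc) C)
        (transport (λ Δ → A * ∷ Δ ⊢ shiftFormula C *)
          (map-*-commute (*-subst (var ∘ suc)) Γ) (*-preserves-⊢ d)))
    *-preserves-⊢ (LLb.contraction d) = contraction (*-preserves-⊢ d)
    *-preserves-⊢ (LLb.weakening d) = weakening (*-preserves-⊢ d)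
    -- `map _* (map !_ Γ)` is not syntactically of the form `map !_ Δ`; stability of its members
    -- suffices.
    *-preserves-⊢ (LLb.promotion {Γ} d) = promote-* (map !_ Γ) (*-preserves-⊢ d)
    *-preserves-⊢ (LLb.dereliction d) = dereliction (*-preserves-⊢ d)

  callByValue-sound : Sound ILb ILL _*
  callByValue-sound =
    (λ _ → *-preserves-⊢) ,
    (λ A → LLb.⊣⊢⇒Equivalent (modular-⊣⊢ callByValue A))

  outerFullGirard-sound : Sound ILb ILL _ᴳᶠ
  outerFullGirard-sound =
    (λ A d → LL.cut (*-preserves-⊢ d) (proj₁ (*⊣⊢ᴳᶠ A))) ,
    (λ A → LLb.⊣⊢⇒Equivalent (modular-⊣⊢ outerFullGirard A))

  -- Comparison of the transforms

  useId-simpler : Simpler useId useT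
  useId-simpler = (λ ()) , λ useT⇒useId → case useT⇒useId refl of λ ()

  identicalOrSimpler-useT : ∀ k → IdenticalOrSimpler k useT
  identicalOrSimpler-useT useT  = inj₁ refl
  identicalOrSimpler-useT useId = inj₂ useId-simpler

  callByValue-isSimplification :
    IsSimplification ILb ILL callByValue outerFullGirard
  callByValue-isSimplification = record
    { equivalent  = callByValue-sound , outerFullGirard-sound ,
                    (λ A → LL.⊣⊢⇒Equivalent (*⊣⊢ᴳᶠ A))
    ; bin-simpler = λ _ → identicalOrSimpler-useT _
    ; mod-simpler = λ _ → identicalOrSimpler-useT _
    ; one-simpler = inj₁ (tensor , useId-simpler)
    }

  -- Reduction from outside

  core : Formula → Formula
  core (atom P)    = atom P
  core (bin c A B) = bin c (A ᴳᶠ) (B ᴳᶠ)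
  core (mod q A)   = mod q (A ᴳᶠ)

  -- `A ᴳᶠ` computes only once the head of `A` is known, whereas `FromOutside` continues on parts of
  -- the form `! B`; this exposes the bang.
  ᴳᶠ≡!core : ∀ A → A ᴳᶠ ≡ ! core A
  ᴳᶠ≡!core (atom P)    = refl
  ᴳᶠ≡!core (bin c A B) = refl
  ᴳᶠ≡!core (mod q A)   = refl

  module _ where
    open ModularOuterTranslation callByValue using (binTransform; modTransform)

    -- A stage affects at most the outermost bang and leaves the translated parts intact, so the
    -- induction continues on them. Abstracting from the relation covers both the transform
    -- reductions and the four reductions of `_↦_`.
    ᴳᶠ-fromOutside : ∀ {_⇝_ : Formula → Formula → Set} →
      (∀ P C → ¬ ((! atom P) ⇝ C)) →
      (∀ c A B → Stage _⇝_ (! bin c (! A) (! B)) (binTransform c (! A) (! B))) →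
      (∀ q A → Stage _⇝_ (! mod q (! A)) (modTransform q (! A))) →
      ∀ A → FromOutside _⇝_ callByValue (A ᴳᶠ) (A *)
    ᴳᶠ-fromOutside {_⇝_} atom-irreducible bin-stage mod-stage A
      rewrite ᴳᶠ≡!core A = go A
      where
      open ModularOuterTranslation callByValue using (tr-bin; tr-mod)

      go : ∀ A → FromOutside _⇝_ callByValue (! core A) (A *)
      go (atom P) = atom P (atom-irreducible P)
      -- For a variable `c` the translation `_*` does not compute; `tr-bin` presents it as a
      -- transform.
      go (bin c A B) rewrite ᴳᶠ≡!core A | ᴳᶠ≡!core B | tr-bin c A B =
        bin c (bin-stage c (core A) (core B)) (go A) (go B)
      go (mod q A) rewrite ᴳᶠ≡!core A | tr-mod q A =
        mod q (mod-stage q (core A)) (go A)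

    fromOutside-transforms : ∀ A →
      FromOutside (TransformReduction outerFullGirard callByValue) callByValue
        (A ᴳᶠ) (A *)
    fromOutside-transforms = ᴳᶠ-fromOutside (λ _ _ ())
      -- A transform reduction matches at every compound formula; it changes nothing where
      -- `callByValue` keeps the bang.
      (λ c A B → inj₁ (bin c A B)) (λ q A → inj₁ (mod q A))

    fromOutside-↦ : ∀ A → FromOutside _↦_ callByValue (A ᴳᶠ) (A *)
    fromOutside-↦ = ᴳᶠ-fromOutside (λ _ _ ()) bin-stage mod-stage
      where
      bin-stage : ∀ c A B → Stage _↦_ (! bin c (! A) (! B)) (binTransform c (! A) (! B))
      bin-stage tensor A B = inj₁ (⊗↦ A B)
      -- No redex of `_↦_` has this shape, so the stage leaves the formula, with its bang, as it is.
      bin-stage with′  A B = inj₂ ((λ _ ()) , refl)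
      bin-stage plus   A B = inj₁ (⊕↦ A B)
      bin-stage lolli  A B = inj₂ ((λ _ ()) , refl)

      mod-stage : ∀ q A → Stage _↦_ (! mod q (! A)) (modTransform q (! A))
      mod-stage forall′ A = inj₂ ((λ _ ()) , refl)
      mod-stage exists  A = inj₁ (∃↦ A)
      mod-stage bang    A = inj₁ (!↦ A)

  -- Reversibility of the reductions in ILL

  stable-reduct : ∀ {A B} → A ↦ B → A ≡ ! B × LL.Stable B
  stable-reduct (⊗↦ A B) = refl , LL.stable-⊗ LL.stable-! LL.stable-!
  stable-reduct (⊕↦ A B) = refl , LL.stable-⊕ LL.stable-! LL.stable-!
  stable-reduct (∃↦ A)   = refl , LL.stable-∃ LL.stable-!
  stable-reduct (!↦ A)   = refl , LL.stable-!

  -- Each reduction only drops the outer bang of a stable formula, and stability gives it back.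
  ↦-reversible : ∀ {A B} → A ↦ B → Equivalent ILL A B
  ↦-reversible r with stable-reduct r
  ... | refl , s = LL.⊣⊢⇒Equivalent (swap (LL.stable⇒⊣⊢ s))

proposition9 : (𝓢 : Signature) → let open LinearLogic 𝓢 in
    IsSimplificationFromOutside ILb ILL callByValue outerFullGirard
    × (∀ A → FromOutside _↦_ callByValue (A ᴳᶠ) (A *))
    × (∀ {A B} → A ↦ B → Equivalent ILL A B)
proposition9 𝓢 =
  record
    { isSimplification = callByValue-isSimplification 𝓢
    ; fromOutside      = fromOutside-transforms 𝓢
    } ,
  fromOutside-↦ 𝓢 ,
  ↦-reversible 𝓢
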